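{- For $n\ge 1$ let $N(n)$ be the Nimber of the game Cycles with Sources played on the line segment with $n$ edges, all edges being initially unmarked. Then $(N(1),N(2),\dots,N(18))$ is $$0,1,0,1,0,3,2,0,2,3,0,1,0,1,0,5,7,0,$$ and from $n=19$ on the values repeat with period $17$ the sequence $$1,0,1,0,3,2,4,5,3,0,1,0,1,0,5,7,8.$$ That is, if $(c_0,\dots,c_{16})$ denotes this last sequence, then $N(n)=c_{(n-19)\bmod 17}$ for all $n\ge 19$.
   Context: The line segment with $n$ edges is the path graph with $n+1$ vertices $v_0,\dots,v_n$ and edges $v_{j-1}v_j$, $1\le j\le n$. Cycles with Sources is the following two-player impartial game on a graph. Initially all edges are unmarked. The players alternate; a move consists of choosing an unmarked edge and marking it with an arrow in one of its two directions, subject to the rule that no move may create a sink. A sink is a vertex all of whose incident edges are marked and directed toward it (in particular, an endpoint of the path, which has only one incident edge, becomes a sink if that edge is directed toward it). Creating sources (vertices all of whose incident edges are marked and directed away from them) is allowed. On a path, a player with no legal move loses. The Nimber (Sprague–Grundy value) of a position is the mex (minimum excluded non-negative integer) of the Nimbers of all positions reachable in one move. -}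

module Defs where

open import Data.Fin using (Fin; zero; suc; toℕ; fromℕ<; inject; inject₁)
open import Data.Fin.Properties
  using (all?; any?; ¬∀⟶∃¬-smallest; pigeonhole; toℕ-injective; toℕ-inject; toℕ-fromℕ<; <⇒≢; suc-injective)
  renaming (_≟_ to _≟ᶠ_)
open import Data.List using (List; []; _∷_; length; filter; allFin; cartesianProduct)
open import Data.List.Membership.Propositional using (_∈_; _∉_; mapWith∈)
open import Data.List.Membership.Propositional.Properties using (∈-filter⁻)
open import Data.List.Membership.Setoid.Properties using (index-injective)
open import Data.List.Relation.Unary.Any using (index)
open import Data.Maybe using (Maybe; just; nothing)
open import Data.Maybe.Properties using (≡-dec)
open import Data.Maybe.Relation.Unary.Any using (Any; dec)
open import Data.Nat using (ℕ; zero; suc; _<_; s≤s)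
open import Data.Nat.Induction using (<-wellFounded)
open import Data.Nat.Properties using (≤-refl) renaming (_≟_ to _≟ⁿ_)
open import Data.List.Membership.DecPropositional _≟ⁿ_ using (_∈?_)
open import Data.Product using (_×_; _,_; proj₁; proj₂; ∃)
open import Data.Sum using (_⊎_)
open import Data.Vec using (Vec; _∷_; lookup; replicate; count; _[_]≔_)
open import Function using (_on_)
open import Induction.WellFounded using (WellFounded; module All)
open import Level using (0ℓ)
open import Relation.Binary.Construct.On using (wellFounded)
open import Relation.Binary.Definitions using (DecidableEquality)
open import Relation.Binary.PropositionalEquality
  using (_≡_; _≢_; refl; trans; subst; setoid)
open import Relation.Nullary using (¬_; Dec; yes; no; ¬?; contradiction; _×-dec_; _⊎-dec_; _→-dec_)

IsMex : List ℕ → ℕ → Set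
IsMex xs k = k ∉ xs × (∀ {j} → j < k → j ∈ xs)

some-missing : ∀ xs → ¬ (∀ (i : Fin (suc (length xs))) → toℕ i ∈ xs)
some-missing xs f with i , j , i<j , eq ← pigeonhole ≤-refl (λ i → index (f i))
  = contradiction (toℕ-injective (index-injective (setoid ℕ) (f i) (f j) eq)) (<⇒≢ i<j)

mex-exists : ∀ xs → ∃ (IsMex xs)
mex-exists xs
  with i , i∉xs , below ← ¬∀⟶∃¬-smallest (suc (length xs)) (λ i → toℕ i ∈ xs)
                            (λ i → toℕ i ∈? xs) (some-missing xs)
  = toℕ i , i∉xs , λ {j} j<i →
      subst (_∈ xs) (trans (toℕ-inject (fromℕ< j<i)) (toℕ-fromℕ< j<i)) (below (fromℕ< j<i))

mex : List ℕ → ℕ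
mex xs = proj₁ (mex-exists xs)

-- The choice of tail and head is only a reference orientation, used to name
-- the two directions of an edge; the graph itself is undirected.
record Graph : Set where
  field
    #vertices : ℕ
    #edges    : ℕ
    tail head : Fin #edges → Fin #vertices
    loopless  : ∀ e → tail e ≢ head e

data Direction : Set where
  forward backward : Direction

_≟ᵈ_ : DecidableEquality Direction
forward  ≟ᵈ forward  = yes refl
forward  ≟ᵈ backward = no λ ()
backward ≟ᵈ forward  = no λ ()
backward ≟ᵈ backward = yes refl

Mark : Set
Mark = Maybe Direction

unmarked? : (m : Mark) → Dec (m ≡ nothing)
unmarked? m = ≡-dec _≟ᵈ_ m nothing

module CyclesWithSources (G : Graph) where
  open Graph G

  target : Fin #edges → Direction → Fin #vertices
  target e forward  = head e
  target e backward = tail e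

  Incident : Fin #vertices → Fin #edges → Set
  Incident v e = tail e ≡ v ⊎ head e ≡ v

  Position : Set
  Position = Vec Mark #edges

  initial : Position
  initial = replicate #edges nothing

  MarkedTowards : Position → Fin #edges → Fin #vertices → Set
  MarkedTowards p e v = Any (λ d → target e d ≡ v) (lookup p e)

  Sink : Position → Fin #vertices → Set
  Sink p v = ∀ e → Incident v e → MarkedTowards p e v

  Move : Set
  Move = Fin #edges × Direction

  play : Position → Move → Position
  play p (e , d) = p [ e ]≔ just d

  CreatesSink : Position → Move → Set
  CreatesSink p m = ∃ λ v → ¬ Sink p v × Sink (play p m) v

  Legal : Position → Move → Set
  Legal p m = lookup p (proj₁ m) ≡ nothing × ¬ CreatesSink p m

  sink? : ∀ p v → Dec (Sink p v)
  sink? p v = all? λ e →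
    (tail e ≟ᶠ v ⊎-dec head e ≟ᶠ v) →-dec dec (λ d → target e d ≟ᶠ v) (lookup p e)

  legal? : ∀ p m → Dec (Legal p m)
  legal? p m = unmarked? (lookup p (proj₁ m))
    ×-dec ¬? (any? λ v → ¬? (sink? p v) ×-dec sink? (play p m) v)

  allMoves : List Move
  allMoves = cartesianProduct (allFin #edges) (forward ∷ backward ∷ [])

  legalMoves : Position → List Move
  legalMoves p = filter (legal? p) allMoves

  #unmarked : Position → ℕ
  #unmarked = count unmarked?

  _≺_ : Position → Position → Set
  _≺_ = _<_ on #unmarked

  ≺-wellFounded : WellFounded _≺_
  ≺-wellFounded = wellFounded #unmarked <-wellFounded

  mark-decreases : ∀ {n} (p : Vec Mark n) e {d} → lookup p e ≡ nothing →
                   count unmarked? (p [ e ]≔ just d) < count unmarked? p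
  mark-decreases (nothing ∷ p) zero    _  = ≤-refl
  mark-decreases (nothing ∷ p) (suc e) eq = s≤s (mark-decreases p e eq)
  mark-decreases (just x ∷ p)  (suc e) eq = mark-decreases p e eq

  legal-decreases : ∀ p {m} → m ∈ legalMoves p → play p m ≺ p
  legal-decreases p {e , d} m∈ = mark-decreases p e
    (proj₁ (proj₂ (∈-filter⁻ (legal? p) {v = e , d} {xs = allMoves} m∈)))

  -- Value under the convention that a player with no legal move loses.  On
  -- graphs with cycles the game may have a further winning condition, which
  -- is void on a path.
  nimber : Position → ℕ
  nimber = All.wfRec ≺-wellFounded 0ℓ (λ _ → ℕ) λ p rec →
    mex (mapWith∈ (legalMoves p) λ {m} m∈ → rec {play p m} (legal-decreases p m∈))

-- Edge j joins vertices j and j + 1 (both counted from 0).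
lineSegment : ℕ → Graph
lineSegment n = record
  { #vertices = suc n
  ; #edges    = n
  ; tail      = inject₁
  ; head      = suc
  ; loopless  = inject₁≢suc
  }
  where
  inject₁≢suc : ∀ {n} (e : Fin n) → inject₁ e ≢ suc e
  inject₁≢suc zero    ()
  inject₁≢suc (suc e) eq = inject₁≢suc e (suc-injective eq)

N : ℕ → ℕ
N n = nimber initial
  where open CyclesWithSources (lineSegment n)

{-# OPTIONS --safe #-}
-- Call an end of a run of unmarked edges free if an arrow towards it creates no
-- sink, and blocked otherwise (the ends of the path are blocked).  Let a run of
-- n edges with f free ends be a heap of size 2n + f.  Marking an edge of the run
-- leaves a free end behind the arrow and a blocked end in front of it, and it is
-- legal exactly when both new heaps are nonzero, so the moves from a heap of size
-- h are to pairs of nonzero heaps x, y with x + y = h - 1.  This is the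
-- octal game 0.4 (Dawson's Kayles up to a shift), whose Grundy values g have
-- period 34 from 54 on; as h ≥ 176 forces one of x, y into the range ≥ 54 + 34,
-- it suffices to check the values below 176.  Finally N(n) = g(2n).
module Submission where

open import Data.Bool using (if_then_else_)
open import Data.Fin using (Fin; zero; suc; toℕ; fromℕ<; combine; remQuot)
import Data.Fin as Fin
import Data.Fin.Properties as Fin
open import Data.List using (List; []; _∷_)
import Data.List as List
open import Data.List.Membership.Propositional using (_∈_; mapWith∈)
open import Data.List.Membership.Propositional.Properties
  using (∈-map⁺; ∈-map⁻; ∈-filter⁺; ∈-filter⁻; ∈-cartesianProduct⁺; ∈-allFin; mapWith∈-cong; mapWith∈≗map)
open import Data.List.Properties using (∷-injectiveˡ)
open import Data.List.Relation.Unary.Any using (here; there)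
open import Data.Maybe using (just; nothing)
open import Data.Maybe.Relation.Unary.Any using (just)
import Data.Maybe.Relation.Unary.Any as Maybe
open import Data.Nat
  using (ℕ; zero; suc; _+_; _*_; _∸_; _^_; _<_; _≤_; s≤s; z≤n; NonZero; >-nonZero⁻¹; _<?_; _≤?_)
open import Data.Nat.DivMod using (_mod_; [m+n]%n≡m%n)
open import Data.Nat.Induction using (<-rec)
open import Data.Nat.Properties
open import Data.Product using (∃; ∃₂; _×_; _,_; proj₁; proj₂)
open import Data.Sum using (_⊎_; inj₁; inj₂; [_,_]′)
open import Data.Vec using (Vec; []; _∷_; lookup; map; tabulate; _[_]≔_)
open import Data.Vec.Properties using (lookup∘update; lookup∘update′; tabulate-cong)
open import Function using (_∘_; case_of_)
open import Induction.WellFounded using (WfRec; module FixPoint; module All)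
open import Level using (0ℓ)
open import Relation.Binary.Definitions using (tri<; tri≈; tri>)
open import Relation.Binary.PropositionalEquality
open import Relation.Nullary
  using (¬_; Dec; does; yes; no; ¬?; contradiction; _×-dec_; _→-dec_; _⊎-dec_; from-yes)
open import Relation.Nullary.Decidable using (map′)
open import Defs

-- Nim-sums of four-bit numbers.

-- The heaps have Grundy values below 16, and so do their nim-sums.
Value : Set
Value = Fin 16

infixr 6 _⊕_

-- Binary addition without carry: `remQuot` splits off the leading digit, and the leading digit of
-- the sum is 0 when the two agree and 1 otherwise.
nimSum : ∀ k → Fin (2 ^ k) → Fin (2 ^ k) → Fin (2 ^ k)
nimSum zero    _ _ = zero
nimSum (suc k) u v with remQuot {2} (2 ^ k) u | remQuot {2} (2 ^ k) v
... | a , u′ | b , v′ =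
  combine (if does (a Fin.≟ b) then zero {1} else suc zero) (nimSum k u′ v′)

opaque
  _⊕_ : Value → Value → Value
  _⊕_ = nimSum 4

  ⊕-comm : ∀ u v → u ⊕ v ≡ v ⊕ u
  ⊕-comm = from-yes (Fin.all? λ u → Fin.all? λ v → u ⊕ v Fin.≟ v ⊕ u)

  ⊕-identityʳ : ∀ u → u ⊕ zero ≡ u
  ⊕-identityʳ = from-yes (Fin.all? λ u → u ⊕ zero Fin.≟ u)

  ⊕-involutive : ∀ u v → u ⊕ u ⊕ v ≡ v
  ⊕-involutive = from-yes (Fin.all? λ u → Fin.all? λ v → u ⊕ u ⊕ v Fin.≟ v)

  ⊕-assoc : ∀ u v w → (u ⊕ v) ⊕ w ≡ u ⊕ v ⊕ w
  ⊕-assoc = from-yes (Fin.all? λ u → Fin.all? λ v → Fin.all? λ w →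
    (u ⊕ v) ⊕ w Fin.≟ u ⊕ v ⊕ w)

  -- The arithmetic behind the Sprague-Grundy theorem. At the highest digit where `w` and `u ⊕ v`
  -- differ, the latter has a 1, so `u` or `v` has a 1 there, and replacing that one by `w ⊕ v` or
  -- `u ⊕ w` lowers it.
  ⊕-reach : ∀ u v w → w Fin.< u ⊕ v → w ⊕ v Fin.< u ⊎ u ⊕ w Fin.< v
  ⊕-reach = from-yes (Fin.all? λ u → Fin.all? λ v → Fin.all? λ w →
    (w Fin.<? u ⊕ v) →-dec ((w ⊕ v Fin.<? u) ⊎-dec (u ⊕ w Fin.<? v)))

⊕-cancelˡ : ∀ u {v w} → u ⊕ v ≡ u ⊕ w → v ≡ w
⊕-cancelˡ u {v} {w} eq =
  trans (sym (⊕-involutive u v)) (trans (cong (u ⊕_) eq) (⊕-involutive u w))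

-- Eventually periodic sequences and the table of heap values.

preperiodic : ∀ {A : Set} {s p} → Vec A s → Vec A (suc p) → ℕ → A
preperiodic []       ys n       = lookup ys (n mod _)
preperiodic (x ∷ _)  _  zero    = x
preperiodic (_ ∷ xs) ys (suc n) = preperiodic xs ys n

preperiodic-periodic : ∀ {A : Set} {s p} (xs : Vec A s) (ys : Vec A (suc p)) {n} →
                       s ≤ n → preperiodic xs ys (n + suc p) ≡ preperiodic xs ys n
preperiodic-periodic {p = p} [] ys {n} z≤n = cong (lookup ys)
  (Fin.fromℕ<-cong _ _ ([m+n]%n≡m%n n (suc p)) _ _)
preperiodic-periodic (_ ∷ xs) ys (s≤s s≤n) = preperiodic-periodic xs ys s≤n

-- From `s + p` on, a step back by `p` stays at or above `s`, where `step` applies.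
periodic-induction : ∀ {P : ℕ → Set} s p .{{_ : NonZero p}} →
                     (∀ {n} → n < s + p → P n) →
                     (∀ {n} → s ≤ n → P n → P (n + p)) → ∀ n → P n
periodic-induction {P} s p base step = <-rec P λ n rec → case n <? s + p of λ where
  (yes n<s+p) → base n<s+p
  (no  n≮s+p) →
    let s+p≤n = ≮⇒≥ n≮s+p
        p≤n   = m+n≤o⇒n≤o s s+p≤n
    in subst P (m∸n+n≡m p≤n)
         (step (m+n≤o⇒m≤o∸n s s+p≤n) (rec (∸-monoʳ-< (>-nonZero⁻¹ p) p≤n)))

g-preperiod : Vec Value 54
g-preperiod = map (_mod 16)
  ( 0 ∷ 0 ∷ 0 ∷ 1 ∷ 1 ∷ 2 ∷ 0 ∷ 3 ∷ 1 ∷ 1 ∷ 0 ∷ 3 ∷ 3 ∷ 2 ∷ 2 ∷ 4 ∷ 0 ∷ 5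
  ∷ 2 ∷ 2 ∷ 3 ∷ 3 ∷ 0 ∷ 1 ∷ 1 ∷ 3 ∷ 0 ∷ 2 ∷ 1 ∷ 1 ∷ 0 ∷ 4 ∷ 5 ∷ 2 ∷ 7 ∷ 4
  ∷ 0 ∷ 1 ∷ 1 ∷ 2 ∷ 0 ∷ 3 ∷ 1 ∷ 1 ∷ 0 ∷ 3 ∷ 3 ∷ 2 ∷ 2 ∷ 4 ∷ 4 ∷ 5 ∷ 5 ∷ 2
  ∷ [])

g-period : Vec Value 34
g-period = map (_mod 16)
  ( 3 ∷ 3 ∷ 0 ∷ 1 ∷ 1 ∷ 3 ∷ 0 ∷ 2 ∷ 1 ∷ 1 ∷ 0 ∷ 4 ∷ 5 ∷ 3 ∷ 7 ∷ 4 ∷ 8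
  ∷ 1 ∷ 1 ∷ 2 ∷ 0 ∷ 3 ∷ 1 ∷ 1 ∷ 0 ∷ 3 ∷ 3 ∷ 2 ∷ 2 ∷ 4 ∷ 4 ∷ 5 ∷ 5 ∷ 9
  ∷ [])

opaque
  g : ℕ → Value
  g = preperiodic g-preperiod g-period

  g-periodic : ∀ {n} → 54 ≤ n → g (n + 34) ≡ g n
  g-periodic = preperiodic-periodic g-preperiod g-period

-- The mex rule for a single heap.

Splits : ℕ → ℕ → ℕ → Set
Splits h x y = 0 < x × 0 < y × suc (x + y) ≡ h

SplitValue : ℕ → Value → Set
SplitValue h v = ∃₂ λ x y → Splits h x y × g x ⊕ g y ≡ v

splitValue? : ∀ h v → Dec (SplitValue h v)
splitValue? h v = map′ (to h) from
  -- The parts are `suc x` and `h ∸ 2 ∸ x`. The bound makes the second part nonzero, and for `h ≤ 2`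
  -- the search range is empty.
  (anyUpTo? (λ x → g (suc x) ⊕ g (h ∸ 2 ∸ x) Fin.≟ v) (h ∸ 2))
  where
  to : ∀ h → (∃ λ x → x < h ∸ 2 × g (suc x) ⊕ g (h ∸ 2 ∸ x) ≡ v) → SplitValue h v
  to (suc (suc h)) (x , x<h , eq) =
    suc x , h ∸ x , (s≤s z≤n , m<n⇒0<n∸m x<h , cong (2 +_) (m+[n∸m]≡n (<⇒≤ x<h))) , eq
  from : SplitValue h v → ∃ λ x → x < h ∸ 2 × g (suc x) ⊕ g (h ∸ 2 ∸ x) ≡ v
  from (suc x , y , (_ , 0<y , refl) , eq) =
    x , m<m+n x 0<y , trans (cong (λ z → g (suc x) ⊕ g z) (m+n∸m≡n x y)) eq

record Mex (O : Value → Set) (v : Value) : Set where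
  constructor _,_
  field
    excluded : ¬ O v
    below    : ∀ w → w Fin.< v → O w

open Mex

mex? : ∀ {O} → (∀ w → Dec (O w)) → ∀ v → Dec (Mex O v)
mex? O? v = map′ (λ (p , q) → p , q) (λ m → excluded m , below m)
  (¬? (O? v) ×-dec Fin.all? λ w → (w Fin.<? v) →-dec O? w)

opaque
  unfolding _⊕_ g

  g-mex-finite : ∀ {n} → n < 176 → Mex (SplitValue n) (g n)
  g-mex-finite = from-yes (allUpTo? (λ n → mex? (splitValue? n) (g n)) 176)

large-summand : ∀ k x y → k + k ≤ suc (x + y) → k ≤ x ⊎ k ≤ y
large-summand k x y 2k≤ = case k ≤? x of λ where
  (yes k≤x) → inj₁ k≤x
  (no  k≰x) → inj₂ (+-cancelˡ-≤ k k y (≤-trans 2k≤ (+-monoˡ-≤ y (≰⇒> k≰x))))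

-- One of the two parts lies in the periodic range; by symmetry it is the first.
splitValue-cases : ∀ {h v} k (Goal : Set) → k + k ≤ h → SplitValue h v →
                   (∀ x y → k ≤ x → Splits h x y → g x ⊕ g y ≡ v → Goal) → Goal
splitValue-cases k Goal 2k≤h (x , y , s@(0<x , 0<y , refl) , eq) f with large-summand k x y 2k≤h
... | inj₁ k≤x = f x y k≤x s eq
... | inj₂ k≤y = f y x k≤y (0<y , 0<x , cong suc (+-comm y x)) (trans (⊕-comm (g y) (g x)) eq)

sum-shift : ∀ x y p → (x + p) + y ≡ (x + y) + p
sum-shift x y p = trans (+-assoc x p y) (trans (cong (x +_) (+-comm p y)) (sym (+-assoc x y p)))

-- Since 108 = 2 * 54, one part lies in the periodic range of `g` and can grow by 34.
splitValue-raise : ∀ {h v} → 108 ≤ h → SplitValue h v → SplitValue (h + 34) v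
splitValue-raise {h} 108≤h sv = splitValue-cases 54 _ 108≤h sv
  λ x y 54≤x (0<x , 0<y , eq) val →
    x + 34 , y ,
    (≤-trans 0<x (m≤m+n x 34) , 0<y , trans (cong suc (sum-shift x y 34)) (cong (_+ 34) eq)) ,
    trans (cong (_⊕ g y) (g-periodic 54≤x)) val

-- Since 176 = 2 * (54 + 34), one part can shrink by 34 and still lie in the periodic range.
splitValue-lower : ∀ {h v} → 176 ≤ h + 34 → SplitValue (h + 34) v → SplitValue h v
splitValue-lower {h} 176≤ sv = splitValue-cases 88 _ 176≤ sv
  λ x y 88≤x (_ , 0<y , eq) val →
    let 54≤x-34 = m+n≤o⇒m≤o∸n 54 88≤x
        x-34+34≡x = m∸n+n≡m (≤-trans (m≤n+m 34 54) 88≤x)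
    in x ∸ 34 , y ,
       (≤-trans (s≤s z≤n) 54≤x-34 , 0<y ,
        +-cancelʳ-≡ 34 _ _ (trans (sym (cong suc (sum-shift (x ∸ 34) y 34)))
                             (trans (cong (λ z → suc (z + y)) x-34+34≡x) eq))) ,
       trans (cong (_⊕ g y) (trans (sym (g-periodic 54≤x-34)) (cong g x-34+34≡x))) val

MexAt : ℕ → Set
MexAt n = Mex (SplitValue n) (g n)

-- Heaps `n` and `n + 34` have the same option values. The bound is 142 = 176 - 34, as required for
-- lowering; raising only needs 108.
g-mex-step : ∀ {n} → 142 ≤ n → MexAt n → MexAt (n + 34)
g-mex-step {n} 142≤n m =
  subst (Mex (SplitValue (n + 34))) (sym (g-periodic (≤-trans (m≤m+n 54 88) 142≤n)))
    ( (λ s → excluded m (splitValue-lower (+-monoˡ-≤ 34 142≤n) s))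
    , (λ w w<gn → splitValue-raise (≤-trans (m≤m+n 108 34) 142≤n) (below m w w<gn)))

opaque
  g-mex : ∀ n → MexAt n
  g-mex = periodic-induction {P = MexAt} 142 34 g-mex-finite g-mex-step

-- Sums of heaps.

infix 4 _⟶_

data _⟶_ : List ℕ → List ℕ → Set where
  split : ∀ {h x y hs} → Splits h x y → h ∷ hs ⟶ x ∷ y ∷ hs
  skip  : ∀ {h hs hs′} → hs ⟶ hs′ → h ∷ hs ⟶ h ∷ hs′

grundy : List ℕ → Value
grundy = List.foldr (λ h v → g h ⊕ v) zero

-- The Sprague-Grundy theorem for these sums. Cancelling the untouched summand from an option of
-- equal value contradicts the mex rule of the part moved in; for a smaller value, `⊕-reach` tells
-- in which part to move.
grundy-mex : ∀ hs → Mex (λ v → ∃ λ hs′ → hs ⟶ hs′ × grundy hs′ ≡ v) (grundy hs)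
grundy-mex [] = (λ { (_ , () , _) }) , (λ _ ())
grundy-mex (h ∷ hs) = unreached , reached
  where
  r = grundy hs

  unreached : ¬ (∃ λ hs′ → h ∷ hs ⟶ hs′ × grundy hs′ ≡ g h ⊕ r)
  unreached (_ , split {x = x} {y} s , eq) =
    excluded (g-mex h) (x , y , s , ⊕-cancelˡ r (begin
      r ⊕ g x ⊕ g y   ≡⟨ ⊕-comm r _ ⟩
      (g x ⊕ g y) ⊕ r ≡⟨ ⊕-assoc (g x) (g y) r ⟩
      g x ⊕ g y ⊕ r   ≡⟨ eq ⟩
      g h ⊕ r         ≡⟨ ⊕-comm (g h) r ⟩
      r ⊕ g h         ∎))
    where open ≡-Reasoning
  unreached (_ , skip m , eq) = excluded (grundy-mex hs) (_ , m , ⊕-cancelˡ (g h) eq)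

  reached : ∀ w → w Fin.< g h ⊕ r → ∃ λ hs′ → h ∷ hs ⟶ hs′ × grundy hs′ ≡ w
  reached w w< = [ fromHead , fromTail ]′ (⊕-reach (g h) r w w<)
    where
    open ≡-Reasoning

    fromHead : w ⊕ r Fin.< g h → ∃ λ hs′ → h ∷ hs ⟶ hs′ × grundy hs′ ≡ w
    fromHead lt = let x , y , s , eq = below (g-mex h) (w ⊕ r) lt in
      x ∷ y ∷ hs , split s , (begin
        g x ⊕ g y ⊕ r   ≡⟨ ⊕-assoc (g x) (g y) r ⟨
        (g x ⊕ g y) ⊕ r ≡⟨ cong (_⊕ r) eq ⟩
        (w ⊕ r) ⊕ r     ≡⟨ ⊕-comm _ r ⟩
        r ⊕ w ⊕ r       ≡⟨ cong (r ⊕_) (⊕-comm w r) ⟩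
        r ⊕ r ⊕ w       ≡⟨ ⊕-involutive r w ⟩
        w ∎)

    fromTail : g h ⊕ w Fin.< r → ∃ λ hs′ → h ∷ hs ⟶ hs′ × grundy hs′ ≡ w
    fromTail lt = let hs′ , m , eq = below (grundy-mex hs) (g h ⊕ w) lt in
      h ∷ hs′ , skip m , trans (cong (g h ⊕_) eq) (⊕-involutive (g h) w)

-- Positions as sums of heaps.

-- When p continues a run of unmarked edges, room p is its contribution to the
-- heap of that run, and rest p lists the heaps of the later runs.
room : ∀ {n} → Vec Mark n → ℕ
room []                  = 0
room (nothing ∷ p)       = 2 + room p
room (just forward ∷ p)  = 1
room (just backward ∷ p) = 0

rest : ∀ {n} → Vec Mark n → List ℕ
rest []                  = []
rest (nothing ∷ p)       = rest p
rest (just forward ∷ p)  = room p ∷ rest p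
rest (just backward ∷ p) = suc (room p) ∷ rest p

-- `m` is the contribution from the left of `p` to its first run. Two adjacent arrows enclose a run
-- without edges; its heap has size at most 2 and hence no moves.
heaps : ∀ {n} → ℕ → Vec Mark n → List ℕ
heaps m p = m + room p ∷ rest p

-- The mirror image of `room`: for the run to its right, a forward arrow blocks the left end and a
-- backward arrow leaves it free.
after : ℕ → Mark → ℕ
after m nothing         = 2 + m
after m (just forward)  = 0
after m (just backward) = 1

-- The argument m is the size accumulated left of the position, so m = 0 means
-- that an arrow towards its leftmost vertex would create a sink.
data Playable (m : ℕ) : ∀ {n} → Vec Mark n → Fin n → Direction → Set where
  onward : ∀ {n} {p : Vec Mark n} → 0 < room p → Playable m (nothing ∷ p) zero forward
  back   : ∀ {n} {p : Vec Mark n} → 0 < m → Playable m (nothing ∷ p) zero backward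
  later  : ∀ {n x e d} {p : Vec Mark n} → Playable (after m x) p e d → Playable m (x ∷ p) (suc e) d

heaps-nothing : ∀ {n} m (p : Vec Mark n) → heaps (2 + m) p ≡ heaps m (nothing ∷ p)
heaps-nothing m p = cong (_∷ rest p) (sym (trans (+-suc m _) (cong suc (+-suc m _))))

-- A forward arrow on the first edge leaves `m + 1` and `room p`, a backward one `m` and
-- `suc (room p)`. `Playable` asks that the part the arrow points to be nonzero; the other part
-- always is.
play⇒split : ∀ {n m d} {p : Vec Mark n} {e} → Playable m p e d →
             heaps m p ⟶ heaps m (p [ e ]≔ just d)
play⇒split {m = m} (onward {p = p} 0<room) =
  split (m≤n+m 1 m , 0<room , (begin
    suc (m + 1 + room p)   ≡⟨ cong suc (+-assoc m 1 (room p)) ⟩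
    suc (m + suc (room p)) ≡⟨ +-suc m (suc (room p)) ⟨
    m + (2 + room p)       ∎))
  where open ≡-Reasoning
play⇒split {m = m} (back {p = p} 0<m) =
  split (≤-trans 0<m (m≤m+n m 0) , s≤s z≤n , (begin
    suc (m + 0 + suc (room p)) ≡⟨ cong (λ z → suc (z + suc (room p))) (+-identityʳ m) ⟩
    suc (m + suc (room p))     ≡⟨ +-suc m (suc (room p)) ⟨
    m + (2 + room p)           ∎))
  where open ≡-Reasoning
play⇒split {m = m} (later {x = nothing} {e} {d} {p} l) =
  subst₂ _⟶_ (heaps-nothing m p) (heaps-nothing m (p [ e ]≔ just d)) (play⇒split l)
play⇒split (later {x = just forward} l)  = skip (play⇒split l)
play⇒split (later {x = just backward} l) = skip (play⇒split l)

PlayableTo : ∀ {n} → ℕ → Vec Mark n → List ℕ → Set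
PlayableTo m p hs = ∃₂ λ e d → Playable m p e d × heaps m (p [ e ]≔ just d) ≡ hs

PlayableTo-nothing : ∀ {n m hs} (p : Vec Mark n) →
                     PlayableTo (2 + m) p hs → PlayableTo m (nothing ∷ p) hs
PlayableTo-nothing {m = m} p (e , d , l , eq) =
  suc e , d , later l , trans (sym (heaps-nothing m (p [ e ]≔ just d))) eq

-- Settles the case where the run has no unmarked edge left: beyond `x ≥ m` at most one unit
-- remains, too few for `y` and the unit lost in a split.
unsplittable : ∀ {m r x y} → r ≤ 1 → m ≤ x → ¬ Splits (m + r) x y
unsplittable r≤1 m≤x (_ , 0<y , eq) =
  <⇒≢ (s≤s (+-mono-≤ m≤x (≤-trans r≤1 0<y))) (sym eq)

-- Marking the j-th remaining edge backward or forward cuts off a first heap of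
-- size m + 2j or m + 2j + 1, so every size x ≥ m is met by exactly one arrow.
split⇒play : ∀ {n m x y} (p : Vec Mark n) → m ≤ x → Splits (m + room p) x y →
             PlayableTo m p (x ∷ y ∷ rest p)
split⇒play []                  m≤x s = contradiction s (unsplittable z≤n m≤x)
split⇒play (just forward ∷ p)  m≤x s = contradiction s (unsplittable ≤-refl m≤x)
split⇒play (just backward ∷ p) m≤x s = contradiction s (unsplittable z≤n m≤x)
split⇒play {m = m} {x} {y} (nothing ∷ p) m≤x s@(0<x , 0<y , eq)
  with m≤n⇒m<n∨m≡n m≤x
... | inj₂ refl =
  zero , backward , back 0<x , cong₂ (λ a b → a ∷ b ∷ rest p) (+-identityʳ m)
    (sym (+-cancelˡ-≡ m _ _ (suc-injective (trans eq (+-suc m (suc (room p)))))))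
... | inj₁ m<x with m≤n⇒m<n∨m≡n m<x
...   | inj₁ 1+m<x = PlayableTo-nothing p (split⇒play p 1+m<x
          (0<x , 0<y , trans eq (sym (∷-injectiveˡ (heaps-nothing m p)))))
...   | inj₂ refl =
  zero , forward , onward (subst (0 <_) y≡room 0<y) ,
    cong₂ (λ a b → a ∷ b ∷ rest p) (+-comm m 1) (sym y≡room)
  where
  y≡room : y ≡ room p
  y≡room = +-cancelˡ-≡ (2 + m) _ _ (trans eq (trans (+-suc m _) (cong suc (+-suc m _))))

mutual
  rest⇒play : ∀ {n hs} m (p : Vec Mark n) → rest p ⟶ hs →
              ∃₂ λ e d → Playable m p e d × heaps m (p [ e ]≔ just d) ≡ m + room p ∷ hs
  rest⇒play {hs = hs} m (nothing ∷ p) r with rest⇒play (2 + m) p r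
  ... | e , d , l , eq = PlayableTo-nothing p
    (e , d , l , trans eq (cong (_∷ hs) (∷-injectiveˡ (heaps-nothing m p))))
  rest⇒play m (just forward ∷ p) r with heaps⇒play z≤n p r
  ... | e , d , l , eq = suc e , d , later l , cong (_ ∷_) eq
  rest⇒play m (just backward ∷ p) r with heaps⇒play ≤-refl p r
  ... | e , d , l , eq = suc e , d , later l , cong (_ ∷_) eq

  -- `m ≤ 1` means that the first run has no edges to the left of `p`, so every nonzero first part
  -- `x` satisfies the bound `m ≤ x` of `split⇒play`.
  heaps⇒play : ∀ {n m hs} → m ≤ 1 → (p : Vec Mark n) → heaps m p ⟶ hs → PlayableTo m p hs
  heaps⇒play m≤1 p (split s@(0<x , _)) = split⇒play p (≤-trans m≤1 0<x) s
  heaps⇒play _   p (skip r)            = rest⇒play _ p r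

-- Legality and nimbers on an arbitrary graph.

isMex-unique : ∀ {xs k l} → IsMex xs k → IsMex xs l → k ≡ l
isMex-unique {k = k} {l} (k∉ , <k∈) (l∉ , <l∈) with <-cmp k l
... | tri< k<l _ _ = contradiction (<l∈ k<l) k∉
... | tri≈ _ k≡l _ = k≡l
... | tri> _ _ l<k = contradiction (<k∈ l<k) l∉

mex-unique : ∀ {k} xs → IsMex xs k → mex xs ≡ k
mex-unique {k} xs = isMex-unique {xs} {mex xs} {k} (proj₂ (mex-exists xs))

module _ (G : Graph) where
  open Graph G
  open CyclesWithSources G

  legal⇒¬sink : ∀ p e d → Legal p (e , d) → ¬ Sink (play p (e , d)) (target e d)
  legal⇒¬sink p e d (unmarked , safe) sink = safe (target e d , notYet , sink)
    where
    incident : ∀ d → Incident (target e d) e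
    incident forward  = inj₂ refl
    incident backward = inj₁ refl

    notYet : ¬ Sink p (target e d)
    notYet sink₀ = case subst (Maybe.Any _) unmarked (sink₀ e (incident d)) of λ ()

  -- A move can complete a sink only at its target: at any other vertex the remaining edges are
  -- unchanged, and `e`, if incident, points away.
  ¬sink⇒legal : ∀ p e d → lookup p e ≡ nothing → ¬ Sink (play p (e , d)) (target e d) →
                Legal p (e , d)
  ¬sink⇒legal p e d unmarked ¬sink = unmarked , λ (v , ¬sink₀ , sink) →
    case target e d Fin.≟ v of λ where
      (yes refl) → ¬sink sink
      (no  t≢v)  → ¬sink₀ λ e′ inc → case e′ Fin.≟ e of λ where
        (yes refl) → case subst (Maybe.Any _) (lookup∘update e p (just d)) (sink e inc) of λ where
          (just t≡v) → contradiction t≡v t≢v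
        (no e′≢e) → subst (Maybe.Any _) (lookup∘update′ e′≢e p (just d)) (sink e′ inc)

  step : ∀ p → WfRec _≺_ (λ _ → ℕ) p → ℕ
  step p rec = mex (mapWith∈ (legalMoves p) λ {m} m∈ → rec {play p m} (legal-decreases p m∈))

  step-ext : ∀ p {rec rec′ : WfRec _≺_ (λ _ → ℕ) p} →
             (∀ {q} (q≺p : q ≺ p) → rec {q} q≺p ≡ rec′ {q} q≺p) →
             step p (λ {q} → rec {q}) ≡ step p (λ {q} → rec′ {q})
  step-ext p {rec} {rec′} ext = cong mex (mapWith∈-cong (legalMoves p) _ _
    λ {m} m∈ → ext {play p m} (legal-decreases p m∈))


  step-const : ∀ (f : Position → ℕ) p →
               step p (λ {q} _ → f q) ≡ mex (List.map (f ∘ play p) (legalMoves p))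
  step-const f p = cong mex (mapWith∈≗map (f ∘ play p) (legalMoves p))

  nimber-step : ∀ p → nimber p ≡ step p (λ {q} _ → nimber q)
  nimber-step p = FixPoint.unfold-wfRec ≺-wellFounded (λ _ → ℕ) step
    (λ p {rec} {rec′} ext → step-ext p {λ {q} → rec {q}} {λ {q} → rec′ {q}} λ {q} → ext {q}) {p}

  -- Well-founded induction on the unfolded recursion; it reduces computing nimbers to checking the
  -- mex rule for a candidate `f`.
  nimber-unique : ∀ (f : Position → ℕ) →
                  (∀ p → IsMex (List.map (f ∘ play p) (legalMoves p)) (f p)) →
                  ∀ p → nimber p ≡ f p
  nimber-unique f f-mex = All.wfRec ≺-wellFounded 0ℓ (λ p → nimber p ≡ f p) λ p rec → begin
    nimber p                                   ≡⟨ nimber-step p ⟩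
    step p (λ {q} _ → nimber q)                ≡⟨ step-ext p (λ {q} → rec {q}) ⟩
    step p (λ {q} _ → f q)                     ≡⟨ step-const f p ⟩
    mex (List.map (f ∘ play p) (legalMoves p)) ≡⟨ mex-unique _ (f-mex p) ⟩
    f p                                        ∎
    where open ≡-Reasoning

  ∈-legalMoves⁺ : ∀ p {m} → Legal p m → m ∈ legalMoves p
  ∈-legalMoves⁺ p {e , d} = ∈-filter⁺ (legal? p) (∈-cartesianProduct⁺ (∈-allFin e) (∈-directions d))
    where
    ∈-directions : ∀ d → d ∈ forward ∷ backward ∷ []
    ∈-directions forward  = here refl
    ∈-directions backward = there (here refl)

  ∈-legalMoves⁻ : ∀ p {m} → m ∈ legalMoves p → Legal p m
  ∈-legalMoves⁻ p m∈ = proj₂ (∈-filter⁻ (legal? p) {xs = allMoves} m∈)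

-- Sinks and legal moves on the path.

open module Line {n} = CyclesWithSources (lineSegment n)

target-suc : ∀ {n} (e : Fin n) d → target (suc e) d ≡ suc (target e d)
target-suc e forward  = refl
target-suc e backward = refl

-- Sinks of the whole path, seen from the suffix `p`: at the vertex `zero` the edges to the left
-- also count, and `m ≡ 0` says that they do not prevent a sink.
SinkAfter : ∀ {n} → ℕ → Vec Mark n → Fin (suc n) → Set
SinkAfter m p v = (v ≡ zero → m ≡ 0) × Sink p v

room≡0⇒sink : ∀ {n} (p : Vec Mark n) → room p ≡ 0 → Sink p zero
room≡0⇒sink (just backward ∷ p) _ zero    _         = just refl
room≡0⇒sink _                   _ (suc e) (inj₁ ())

sink⇒room≡0 : ∀ {n} (p : Vec Mark n) → Sink p zero → room p ≡ 0
sink⇒room≡0 []      _    = refl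
sink⇒room≡0 (x ∷ p) sink with x | sink zero (inj₁ refl)
... | just forward  | just ()
... | just backward | _ = refl

-- The edge `x` matters for `suc v` only if `v` is `zero`, and it points there exactly when
-- `after m x` is 0.
sink-∷⁻ : ∀ {n v} m x (p : Vec Mark n) → Sink (x ∷ p) (suc v) → SinkAfter (after m x) p v
sink-∷⁻ {n} {v} m x p sink = (λ { refl → first x (sink zero (inj₂ refl)) }) , others
  where
  first : ∀ x → Maybe.Any (λ d → target {suc n} zero d ≡ suc zero) x → after m x ≡ 0
  first (just forward)  _         = refl
  first (just backward) (just ())

  shift : ∀ e → MarkedTowards (x ∷ p) (suc e) (suc v) → MarkedTowards p e v
  shift e = Maybe.map λ {d} t≡ → Fin.suc-injective (trans (sym (target-suc e d)) t≡)

  others : Sink p v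
  others e (inj₁ eq) = shift e (sink (suc e) (inj₁ (cong suc eq)))
  others e (inj₂ eq) = shift e (sink (suc e) (inj₂ (cong suc eq)))

sink-∷⁺ : ∀ {n v} m x (p : Vec Mark n) → SinkAfter (after m x) p v → Sink (x ∷ p) (suc v)
sink-∷⁺ {n} {v} m x p (blocked , sink) = λ where
    zero    (inj₂ refl) → first x (blocked refl)
    (suc e) (inj₁ eq)   → shift e (sink e (inj₁ (Fin.suc-injective eq)))
    (suc e) (inj₂ eq)   → shift e (sink e (inj₂ (Fin.suc-injective eq)))
  where
  first : ∀ x → after m x ≡ 0 → Maybe.Any (λ d → target {suc n} zero d ≡ suc zero) x
  first (just forward) _ = just refl

  shift : ∀ e → MarkedTowards p e v → MarkedTowards (x ∷ p) (suc e) (suc v)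
  shift e = Maybe.map λ {d} t≡ → trans (target-suc e d) (cong suc t≡)

playable⇒unmarked : ∀ {n m d} {p : Vec Mark n} {e} → Playable m p e d → lookup p e ≡ nothing
playable⇒unmarked (onward _) = refl
playable⇒unmarked (back _)   = refl
playable⇒unmarked (later l)  = playable⇒unmarked l

playable⇒¬sink : ∀ {n m d} {p : Vec Mark n} {e} → Playable m p e d →
                 ¬ SinkAfter m (p [ e ]≔ just d) (target e d)
playable⇒¬sink {m = m} (onward {p = p} 0<room) (_ , sink) =
  <⇒≢ 0<room (sym (sink⇒room≡0 p (proj₂ (sink-∷⁻ m (just forward) p sink))))
playable⇒¬sink (back 0<m) (m≡0 , _) = <⇒≢ 0<m (sym (m≡0 refl))
playable⇒¬sink {m = m} {d} (later {x = x} {e} {p = p} l) (_ , sink) =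
  playable⇒¬sink l (sink-∷⁻ m x p′ (subst (Sink (x ∷ p′)) (target-suc e d) sink))
  where p′ = p [ e ]≔ just d

¬sink⇒playable : ∀ {n} m (p : Vec Mark n) e d → lookup p e ≡ nothing →
                 ¬ SinkAfter m (p [ e ]≔ just d) (target e d) → Playable m p e d
¬sink⇒playable m (nothing ∷ p) zero forward  _ ¬sink = onward (n≢0⇒n>0 λ room≡0 →
  ¬sink ((λ ()) , sink-∷⁺ m (just forward) p ((λ _ → refl) , room≡0⇒sink p room≡0)))
¬sink⇒playable m (nothing ∷ p) zero backward _ ¬sink = back (n≢0⇒n>0 λ m≡0 →
  ¬sink ((λ _ → m≡0) , room≡0⇒sink (just backward ∷ p) refl))
¬sink⇒playable m (x ∷ p) (suc e) d unmarked ¬sink = later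
  (¬sink⇒playable (after m x) p e d unmarked λ sink → ¬sink
    ( (λ t≡0 → contradiction (trans (sym t≡0) (target-suc e d)) λ ())
    , subst (Sink (x ∷ p′)) (sym (target-suc e d)) (sink-∷⁺ m x p′ sink)))
  where p′ = p [ e ]≔ just d

legal⇒playable : ∀ {n e d} (p : Vec Mark n) → Legal p (e , d) → Playable 0 p e d
legal⇒playable {n} {e} {d} p legal@(unmarked , _) =
  ¬sink⇒playable 0 p e d unmarked λ (_ , sink) → legal⇒¬sink (lineSegment n) p e d legal sink

playable⇒legal : ∀ {n e d} (p : Vec Mark n) → Playable 0 p e d → Legal p (e , d)
playable⇒legal {n} {e} {d} p l =
  ¬sink⇒legal (lineSegment n) p e d (playable⇒unmarked l) λ sink →
    playable⇒¬sink l ((λ _ → refl) , sink)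

nimber≡grundy : ∀ {n} (p : Vec Mark n) → nimber p ≡ toℕ (grundy (heaps 0 p))
nimber≡grundy {n} = nimber-unique (lineSegment n) f λ p → unreached p , reached p
  where
  f : Vec Mark n → ℕ
  f p = toℕ (grundy (heaps 0 p))

  unreached : ∀ p → ¬ (f p ∈ List.map (f ∘ play p) (legalMoves p))
  unreached p v∈ =
    let (e , d) , m∈ , eq = ∈-map⁻ (f ∘ play p) v∈
    in excluded (grundy-mex (heaps 0 p))
         ( heaps 0 (p [ e ]≔ just d)
         , play⇒split (legal⇒playable p (∈-legalMoves⁻ (lineSegment n) p m∈))
         , Fin.toℕ-injective (sym eq))

  reached : ∀ p {j} → j < f p → j ∈ List.map (f ∘ play p) (legalMoves p)
  reached p {j} j< =
    -- Being smaller than a `Value`, `j` is itself one, so the mex rule for heaps applies to it.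
    let j<16 = <-trans j< (Fin.toℕ<n (grundy (heaps 0 p)))
        hs , move , gr≡j = below (grundy-mex (heaps 0 p)) (fromℕ< j<16)
                             (subst (_< f p) (sym (Fin.toℕ-fromℕ< j<16)) j<)
        e , d , l , heaps≡hs = heaps⇒play z≤n p move
        open ≡-Reasoning
    in subst (_∈ _) (begin
         f (play p (e , d)) ≡⟨ cong (toℕ ∘ grundy) heaps≡hs ⟩
         toℕ (grundy hs)    ≡⟨ cong toℕ gr≡j ⟩
         toℕ (fromℕ< j<16)  ≡⟨ Fin.toℕ-fromℕ< j<16 ⟩
         j                  ∎)
       (∈-map⁺ (f ∘ play p) (∈-legalMoves⁺ (lineSegment n) p (playable⇒legal p l)))

-- The values of `N`.

room-initial : ∀ n → room (initial {n}) ≡ n * 2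
room-initial zero    = refl
room-initial (suc n) = cong (2 +_) (room-initial n)

rest-initial : ∀ n → rest (initial {n}) ≡ []
rest-initial zero    = refl
rest-initial (suc n) = rest-initial n

N≡g : ∀ n → N n ≡ toℕ (g (n * 2))
N≡g n = begin
  N n                                   ≡⟨ nimber≡grundy (initial {n}) ⟩
  toℕ (grundy (heaps 0 (initial {n})))  ≡⟨ cong₂ (λ h hs → toℕ (grundy (h ∷ hs)))
                                               (room-initial n) (rest-initial n) ⟩
  toℕ (g (n * 2) ⊕ zero)                ≡⟨ cong toℕ (⊕-identityʳ (g (n * 2))) ⟩
  toℕ (g (n * 2))                       ∎
  where open ≡-Reasoning

N-preperiod : Vec ℕ 18
N-preperiod = 0 ∷ 1 ∷ 0 ∷ 1 ∷ 0 ∷ 3 ∷ 2 ∷ 0 ∷ 2 ∷ 3 ∷ 0 ∷ 1 ∷ 0 ∷ 1 ∷ 0 ∷ 5 ∷ 7 ∷ 0 ∷ []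

N-period : Vec ℕ 17
N-period = 1 ∷ 0 ∷ 1 ∷ 0 ∷ 3 ∷ 2 ∷ 4 ∷ 5 ∷ 3 ∷ 0 ∷ 1 ∷ 0 ∷ 1 ∷ 0 ∷ 5 ∷ 7 ∷ 8 ∷ []

InPeriod : ℕ → Set
InPeriod j = toℕ (g ((19 + j) * 2)) ≡ lookup N-period (j mod 17)

opaque
  unfolding g

  g-even-preperiod : tabulate {n = 18} (λ i → toℕ (g (suc (toℕ i) * 2))) ≡ N-preperiod
  g-even-preperiod = refl

  g-even-period-base : ∀ {j} → j < 25 → InPeriod j
  g-even-period-base = from-yes
    (allUpTo? (λ j → toℕ (g ((19 + j) * 2)) ≟ lookup N-period (j mod 17)) 25)

-- Seventeen more edges enlarge the heap by 34, and `j = 8` is where `(19 + j) * 2` reaches 54. The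
-- smaller `j` are covered by the direct check of the first 8 + 17 values.
g-even-period-step : ∀ {j} → 8 ≤ j → InPeriod j → InPeriod (j + 17)
g-even-period-step {j} 8≤j eq = begin
  toℕ (g ((19 + (j + 17)) * 2))    ≡⟨ cong (λ h → toℕ (g h)) (*-distribʳ-+ 2 (19 + j) 17) ⟩
  toℕ (g ((19 + j) * 2 + 34))      ≡⟨ cong toℕ (g-periodic (*-monoˡ-≤ 2 (+-monoʳ-≤ 19 8≤j))) ⟩
  toℕ (g ((19 + j) * 2))           ≡⟨ eq ⟩
  -- With an empty preperiod, `preperiodic` is just this lookup.
  lookup N-period (j mod 17)        ≡⟨ preperiodic-periodic [] N-period {j} z≤n ⟨
  lookup N-period ((j + 17) mod 17) ∎
  where open ≡-Reasoning

g-even-period : ∀ j → InPeriod j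
g-even-period = periodic-induction {P = InPeriod} 8 17 g-even-period-base g-even-period-step

N-initial-values : tabulate {n = 18} (λ i → N (suc (toℕ i))) ≡ N-preperiod
N-initial-values = trans
  (tabulate-cong {f = λ i → N (suc (toℕ i))} {λ i → toℕ (g (suc (toℕ i) * 2))}
    λ i → N≡g (suc (toℕ i)))
  g-even-preperiod

N-periodic : ∀ n → 19 ≤ n → N n ≡ lookup N-period ((n ∸ 19) mod 17)
N-periodic n 19≤n = begin
  N n                               ≡⟨ N≡g n ⟩
  toℕ (g (n * 2))                   ≡⟨ cong (λ k → toℕ (g (k * 2))) (m+[n∸m]≡n 19≤n) ⟨
  toℕ (g ((19 + (n ∸ 19)) * 2))     ≡⟨ g-even-period (n ∸ 19) ⟩
  lookup N-period ((n ∸ 19) mod 17) ∎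
  where open ≡-Reasoning

theorem3 : (tabulate {n = 18} (λ i → N (suc (toℕ i)))
    ≡ 0 ∷ 1 ∷ 0 ∷ 1 ∷ 0 ∷ 3 ∷ 2 ∷ 0 ∷ 2 ∷ 3 ∷ 0 ∷ 1 ∷ 0 ∷ 1 ∷ 0 ∷ 5 ∷ 7 ∷ 0 ∷ [])
    × ((n : ℕ) → 19 ≤ n →
    N n ≡ lookup (1 ∷ 0 ∷ 1 ∷ 0 ∷ 3 ∷ 2 ∷ 4 ∷ 5 ∷ 3 ∷ 0 ∷ 1 ∷ 0 ∷ 1 ∷ 0 ∷ 5 ∷ 7 ∷ 8 ∷ [])
    ((n ∸ 19) mod 17))
theorem3 = N-initial-values , N-periodic
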